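{- For all integers $x\ge0$ and $r\ge1$ there is a finite undirected graph $H$ with two specified vertices $s,t$ such that the smallest $s$-$t$ separator of $H$ has size $r$ and the union of all important $s$-$t$ separators of excess at most $x$ has size $2^{x+1}r-r$.
   Context: For disjoint $X,Y\subseteq V(H)$, a set $K\subseteq V(H)\setminus(X\cup Y)$ is an $X$-$Y$ separator if $H\setminus K$ has no path from $X$ to $Y$; an $s$-$t$ separator is a $\{s\}$-$\{t\}$ separator. $NR(H,A,B)$ is the set of vertices not reachable from $A$ in $H\setminus B$. For separators, $K_1\prec^*K_2$ means $NR(H,Y,K_1)\subset NR(H,Y,K_2)$ (proper inclusion). A minimal $X$-$Y$ separator $K$ is important if there is no $X$-$Y$ separator $K'$ with $K\prec^*K'$ and $|K|\ge|K'|$. The excess of an important separator $S$ is $|S|-r_0$, where $r_0$ is the size of a smallest important separator. -}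

module Defs where

open import Data.Fin.Base using (Fin)
open import Data.Fin.Subset using (Subset; _∈_; _∉_; _⊆_; _⊂_; _∪_; ∁; ∣_∣)
open import Data.Nat.Base using (ℕ; _≤_; _≥_; _∸_)
open import Data.Product.Base using (∃-syntax; _×_)
open import Function.Bundles using (_⇔_)
open import Level using (0ℓ)
open import Relation.Binary.Construct.Closure.ReflexiveTransitive using (Star)
open import Relation.Binary.Core using (Rel)
open import Relation.Binary.Definitions using (Symmetric; Decidable)
open import Relation.Binary.PropositionalEquality.Core using (_≡_)
open import Relation.Nullary.Negation.Core using (¬_)
open import Relation.Unary using (Pred) renaming (_⊂_ to _⊂ᵖ_)

record Graph (n : ℕ) : Set₁ where
  field
    Adj    : Rel (Fin n) 0ℓ
    adj?   : Decidable Adj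
    sym    : Symmetric Adj
    irrefl : ∀ {v} → ¬ Adj v v

module _ {n : ℕ} (H : Graph n) where

  open Graph H

  AdjAvoiding : Subset n → Rel (Fin n) 0ℓ
  AdjAvoiding K u v = u ∉ K × v ∉ K × Adj u v

  -- v is a vertex of H ∖ K joined to some vertex of A in H ∖ K.
  -- The condition v ∉ K matters only for the path of length zero.
  Reachable : (A K : Subset n) → Pred (Fin n) 0ℓ
  Reachable A K v = ∃[ a ] (a ∈ A × v ∉ K × Star (AdjAvoiding K) a v)

  -- Ranges over the vertices of H ∖ B, so B itself is excluded.
  NR : (A B : Subset n) → Pred (Fin n) 0ℓ
  NR A B v = v ∉ B × ¬ Reachable A B v

  module _ (X Y : Subset n) where

    IsSeparator : Pred (Subset n) 0ℓ
    IsSeparator K = K ⊆ ∁ (X ∪ Y) × ¬ (∃[ y ] (y ∈ Y × Reachable X K y))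

    IsMinimalSeparator : Pred (Subset n) 0ℓ
    IsMinimalSeparator K =
      IsSeparator K × (∀ K′ → K′ ⊂ K → ¬ IsSeparator K′)

    _≺*_ : Rel (Subset n) 0ℓ
    K₁ ≺* K₂ = NR Y K₁ ⊂ᵖ NR Y K₂

    IsImportantSeparator : Pred (Subset n) 0ℓ
    IsImportantSeparator K =
      IsMinimalSeparator K ×
      ¬ (∃[ K′ ] (IsSeparator K′ × K ≺* K′ × ∣ K ∣ ≥ ∣ K′ ∣))

SmallestSize : {n : ℕ} → Pred (Subset n) 0ℓ → ℕ → Set
SmallestSize P k = (∃[ K ] (P K × ∣ K ∣ ≡ k)) × (∀ K → P K → k ≤ ∣ K ∣)

-- By minimality of r₀ the subtraction is never truncated when S is important.
HasExcess : {n : ℕ} → Graph n → (X Y S : Subset n) → ℕ → Set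
HasExcess H X Y S e =
  ∃[ r₀ ] (SmallestSize (IsImportantSeparator H X Y) r₀ × e ≡ ∣ S ∣ ∸ r₀)

ImportantOfExcessAtMost : {n : ℕ} → Graph n → (X Y : Subset n) → ℕ → Pred (Subset n) 0ℓ
ImportantOfExcessAtMost H X Y x S =
  IsImportantSeparator H X Y S × (∃[ e ] (HasExcess H X Y S e × e ≤ x))

IsUnionOf : {n : ℕ} → Pred (Subset n) 0ℓ → Pred (Subset n) 0ℓ
IsUnionOf P U = ∀ v → v ∈ U ⇔ (∃[ S ] (P S × v ∈ S))

{-# OPTIONS --safe #-}

-- H is a forest of r complete binary trees of depth x, with s joined to every
-- root and t joined to every leaf.  For an ancestor-closed set A of internal
-- nodes let ∂A be the set of nodes outside A that are roots or children of A;
-- then ∣∂A∣ = r + ∣A∣, since ∣A∣ + ∣∂A∣ counts the r roots and the 2∣A∣ children.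
-- If a separator K avoids A, then the set A′ of nodes reached from s downwards
-- in H ∖ K contains A, and ∂A′ ⊆ K.  Hence ∣∂A∣ ≤ ∣∂A′∣ ≤ ∣K∣, and K = ∂A
-- when ∣K∣ ≤ ∣∂A∣; so every ∂A is important.  A node v at depth d lies in ∂A for
-- A the set of its d proper ancestors, so the important separators of excess at
-- most x cover all the nodes.
module Submission where

open import Data.Bool.Base using (Bool; true; false; not; _∧_)
open import Data.Bool.Properties using (¬-not) renaming (_≟_ to _≟ᵇ_)
open import Data.Empty using (⊥; ⊥-elim)
open import Data.Fin.Base using (Fin; zero; suc; toℕ; fromℕ<)
open import Data.Fin.Properties using (toℕ<n; toℕ-fromℕ<)
open import Data.Fin.Subset using (Subset; ∣_∣; ⁅_⁆; _∈_; _∉_; _⊆_; _⊂_; _∪_; ∁)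
open import Data.Fin.Subset.Properties using (x∈p∪q⁻; x∈⁅y⁆⇒x≡y; x∈⁅x⁆; x∉p⇒x∈∁p; p⊂q⇒∣p∣<∣q∣)
open import Data.Maybe.Base using (Maybe; just; nothing; maybe)
import Data.Maybe.Properties as Maybe
open import Data.Nat.Base using (ℕ; zero; suc; _+_; _*_; _∸_; _^_; _≤_; _<_; _≥_; z≤n; s≤s; s≤s⁻¹; ⌊_/2⌋)
open import Data.Nat.Properties
open import Data.Nat.Tactic.RingSolver using (solve-∀)
open import Data.Product.Base using (Σ-syntax; ∃-syntax; _×_; _,_; proj₁; proj₂)
open import Data.Sum.Base using (_⊎_; inj₁; inj₂; swap)
open import Data.Unit.Base using (⊤; tt)
open import Data.Vec.Base using ([]; _∷_; here; there)
open import Function.Base using (_∘_; const)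
open import Function.Bundles using (mk⇔)
open import Relation.Binary.Construct.Closure.ReflexiveTransitive using (Star; ε; _◅_; _◅◅_)
open import Relation.Binary.PropositionalEquality
open import Relation.Nullary.Decidable using (Dec; yes; no; _⊎-dec_; decidable-stable)
open import Relation.Nullary.Negation using (¬_; contradiction)
open import Defs

∧-true⁻ : ∀ a {b} → a ∧ b ≡ true → a ≡ true × b ≡ true
∧-true⁻ true b≡t = refl , b≡t

-- Counting and subsets

bit : Bool → ℕ
bit true  = 1
bit false = 0

count : ℕ → (ℕ → Bool) → ℕ
count zero    f = 0
count (suc n) f = bit (f 0) + count n (f ∘ suc)

count-cong : ∀ n {f g : ℕ → Bool} → (∀ j → j < n → f j ≡ g j) → count n f ≡ count n g
count-cong zero    f≗g = refl
count-cong (suc n) f≗g =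
  cong₂ _+_ (cong bit (f≗g 0 (s≤s z≤n))) (count-cong n (λ j → f≗g (suc j) ∘ s≤s))

bit-mono : ∀ a b → (a ≡ true → b ≡ true) → bit a ≤ bit b
bit-mono false b a⇒b = z≤n
bit-mono true  b a⇒b rewrite a⇒b refl = ≤-refl

count-mono : ∀ n {f g : ℕ → Bool} → (∀ j → j < n → f j ≡ true → g j ≡ true) →
             count n f ≤ count n g
count-mono zero    f⇒g = z≤n
count-mono (suc n) f⇒g =
  +-mono-≤ (bit-mono _ _ (f⇒g 0 (s≤s z≤n))) (count-mono n (λ j → f⇒g (suc j) ∘ s≤s))

-- A place where only `g` holds would make its count strictly larger. In `cut-unique` this turns a
-- comparison of sizes into equality of sets.
count-antisym : ∀ n {f g : ℕ → Bool} → (∀ j → j < n → f j ≡ true → g j ≡ true) →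
                count n g ≤ count n f → ∀ j → j < n → f j ≡ g j
count-antisym (suc n) {f} {g} f⇒g g≤f j j<n with f 0 in f0 | g 0 in g0
... | true | false = contradiction (trans (sym g0) (f⇒g 0 (s≤s z≤n) f0)) λ ()
... | false | true = contradiction (≤-trans g≤f (count-mono n (λ j → f⇒g (suc j) ∘ s≤s))) 1+n≰n
count-antisym (suc n) f⇒g g≤f zero    j<n | true  | true  = trans f0 (sym g0)
count-antisym (suc n) f⇒g g≤f (suc j) j<n | true  | true  =
  count-antisym n (λ j → f⇒g (suc j) ∘ s≤s) (s≤s⁻¹ g≤f) j (s≤s⁻¹ j<n)
count-antisym (suc n) f⇒g g≤f zero    j<n | false | false = trans f0 (sym g0)
count-antisym (suc n) f⇒g g≤f (suc j) j<n | false | false =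
  count-antisym n (λ j → f⇒g (suc j) ∘ s≤s) g≤f j (s≤s⁻¹ j<n)

count-false : ∀ n → count n (const false) ≡ 0
count-false zero    = refl
count-false (suc n) = count-false n

count-true : ∀ n → count n (const true) ≡ n
count-true zero    = refl
count-true (suc n) = cong suc (count-true n)

count-bounded : ∀ {m n} {f : ℕ → Bool} → m ≤ n → (∀ j → f j ≡ true → j < m) →
                count n f ≡ count m f
count-bounded {n = n} z≤n f⇒< =
  trans (count-cong n (λ j _ → ¬-not (λ fj → n≮0 (f⇒< j fj)))) (count-false n)
count-bounded (s≤s m≤n) f⇒< =
  cong (_ +_) (count-bounded m≤n (λ j fj → s≤s⁻¹ (f⇒< (suc j) fj)))

count-split : ∀ n (f g : ℕ → Bool) → (∀ j → g j ≡ true → f j ≡ true) →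
              count n f ≡ count n g + count n (λ j → f j ∧ not (g j))
count-split zero    f g g⇒f = refl
count-split (suc n) f g g⇒f with f 0 in f0 | g 0 in g0
... | true  | true  = cong suc (count-split n _ _ (g⇒f ∘ suc))
... | true  | false =
  trans (cong suc (count-split n _ _ (g⇒f ∘ suc))) (sym (+-suc (count n (g ∘ suc)) _))
... | false | true  = contradiction (trans (sym f0) (g⇒f 0 g0)) λ ()
... | false | false = count-split n _ _ (g⇒f ∘ suc)

-- Each `p` is the half of exactly two numbers, `2p` and `2p + 1`; these become its two children.
count-half : ∀ n (f : ℕ → Bool) → count (n * 2) (f ∘ ⌊_/2⌋) ≡ count n f * 2
count-half zero    f = refl
count-half (suc n) f rewrite count-half n (f ∘ suc) with f 0
... | true  = refl
... | false = refl

_∪ᵇ⁅_⁆ : (ℕ → Bool) → ℕ → ℕ → Bool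
(f ∪ᵇ⁅ p ⁆) j with j ≟ p
... | yes _ = true
... | no  _ = f j

∪ᵇ-inˡ : ∀ f p {j} → f j ≡ true → (f ∪ᵇ⁅ p ⁆) j ≡ true
∪ᵇ-inˡ f p {j} fj with j ≟ p
... | yes _ = refl
... | no  _ = fj

∪ᵇ-inʳ : ∀ f p → (f ∪ᵇ⁅ p ⁆) p ≡ true
∪ᵇ-inʳ f p with p ≟ p
... | yes _  = refl
... | no p≢p = contradiction refl p≢p

∪ᵇ⁻ : ∀ f p {j} → (f ∪ᵇ⁅ p ⁆) j ≡ true → f j ≡ true ⊎ j ≡ p
∪ᵇ⁻ f p {j} h with j ≟ p
... | yes j≡p = inj₂ j≡p
... | no  _   = inj₁ h

∪ᵇ-suc : ∀ f p j → (f ∪ᵇ⁅ suc p ⁆) (suc j) ≡ ((f ∘ suc) ∪ᵇ⁅ p ⁆) j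
∪ᵇ-suc f p j with suc j ≟ suc p | j ≟ p
... | yes _   | yes _   = refl
... | no  _   | no  _   = refl
... | yes j≡p | no  j≢p = contradiction (suc-injective j≡p) j≢p
... | no  j≢p | yes j≡p = contradiction (cong suc j≡p) j≢p

-- Only an inequality, since `p` may already satisfy `f` or lie outside the range.
count-∪ᵇ : ∀ n f p → count n (f ∪ᵇ⁅ p ⁆) ≤ suc (count n f)
count-∪ᵇ zero    f p       = z≤n
count-∪ᵇ (suc n) f zero    = s≤s (m≤n+m (count n (f ∘ suc)) (bit (f 0)))
count-∪ᵇ (suc n) f (suc p) = begin
  bit (f 0) + count n ((f ∪ᵇ⁅ suc p ⁆) ∘ suc)   ≡⟨ cong (bit (f 0) +_) (count-cong n (λ j _ → ∪ᵇ-suc f p j)) ⟩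
  bit (f 0) + count n ((f ∘ suc) ∪ᵇ⁅ p ⁆)       ≤⟨ +-monoʳ-≤ (bit (f 0)) (count-∪ᵇ n (f ∘ suc) p) ⟩
  bit (f 0) + suc (count n (f ∘ suc))           ≡⟨ +-suc (bit (f 0)) _ ⟩
  suc (bit (f 0) + count n (f ∘ suc))           ∎
  where open ≤-Reasoning

-- Sets of nodes are handled as predicates on all of `ℕ`, so that the arithmetic of `parent` stays
-- free of `Fin`; out of range the value is `false`.
mem : ∀ {n} → Subset n → ℕ → Bool
mem []      _       = false
mem (b ∷ S) zero    = b
mem (b ∷ S) (suc j) = mem S j

∈⇒mem : ∀ {n} {S : Subset n} {i} → i ∈ S → mem S (toℕ i) ≡ true
∈⇒mem here      = refl
∈⇒mem (there h) = ∈⇒mem h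

mem⇒∈ : ∀ {n} (S : Subset n) i → mem S (toℕ i) ≡ true → i ∈ S
mem⇒∈ (true ∷ S) zero    refl = here
mem⇒∈ (b ∷ S)    (suc i) h    = there (mem⇒∈ S i h)

subset : ∀ n → (ℕ → Bool) → Subset n
subset zero    f = []
subset (suc n) f = f 0 ∷ subset n (f ∘ suc)

mem-subset : ∀ n f {j} → j < n → mem (subset n f) j ≡ f j
mem-subset (suc n) f {zero}  _     = refl
mem-subset (suc n) f {suc j} j<n   = mem-subset n (f ∘ suc) (s≤s⁻¹ j<n)

subset-cong : ∀ n {f} {S : Subset n} → (∀ j → j < n → f j ≡ mem S j) → subset n f ≡ S
subset-cong zero    {S = []}    _   = refl
subset-cong (suc n) {S = b ∷ S} f≗S =
  cong₂ _∷_ (f≗S 0 (s≤s z≤n)) (subset-cong n (λ j → f≗S (suc j) ∘ s≤s))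

∣S∣≡count : ∀ {n} (S : Subset n) → ∣ S ∣ ≡ count n (mem S)
∣S∣≡count []          = refl
∣S∣≡count (true  ∷ S) = cong suc (∣S∣≡count S)
∣S∣≡count (false ∷ S) = ∣S∣≡count S

∣subset∣ : ∀ n f → ∣ subset n f ∣ ≡ count n f
∣subset∣ n f = trans (∣S∣≡count (subset n f)) (count-cong n (λ j → mem-subset n f))

-- The forest

-- Nodes are numbered breadth first, so that the children of i are r + 2i and r + 2i + 1.
parent : ℕ → ℕ → Maybe ℕ
parent zero    j       = just ⌊ j /2⌋
parent (suc r) zero    = nothing
parent (suc r) (suc j) = parent r j

parent-≤ : ∀ r j {p} → parent r j ≡ just p → r + p ≤ j
parent-≤ zero    j       refl = ⌊n/2⌋≤n j
parent-≤ (suc r) (suc j) eq   = s≤s (parent-≤ r j eq)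

-- With no roots, node 0 would be its own parent, whence `r ≥ 1`. The fuel arguments for `reachFuel`
-- rest on this descent.
parent-<j : ∀ r j {p} → r ≥ 1 → parent r j ≡ just p → p < j
parent-<j r j {p} r≥1 eq = ≤-trans (+-monoˡ-≤ p r≥1) (parent-≤ r j eq)

half-< : ∀ m j → j < m * 2 → ⌊ j /2⌋ < m
half-< (suc m) zero          _                 = s≤s z≤n
half-< (suc m) (suc zero)    _                 = s≤s z≤n
half-< (suc m) (suc (suc j)) (s≤s (s≤s j<m*2)) = s≤s (half-< m j j<m*2)

parent-<m : ∀ r m j {p} → j < r + m * 2 → parent r j ≡ just p → p < m
parent-<m zero    m j       j<   refl = half-< m j j<
parent-<m (suc r) m (suc j) j<   eq   = parent-<m r m j (s≤s⁻¹ j<) eq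

half-<⁻ : ∀ m j → ⌊ j /2⌋ < m → j < m * 2
half-<⁻ (suc m) zero          _ = s≤s z≤n
half-<⁻ (suc m) (suc zero)    _ = s≤s (s≤s z≤n)
half-<⁻ (suc m) (suc (suc j)) h = s≤s (s≤s (half-<⁻ m j (s≤s⁻¹ h)))

child-< : ∀ r m j {p} → parent r j ≡ just p → p < m → j < r + m * 2
child-< zero    m j       refl p<m = half-<⁻ m j p<m
child-< (suc r) m (suc j) eq   p<m = s≤s (child-< r m j eq p<m)

root-< : ∀ r j → parent r j ≡ nothing → j < r
root-< (suc r) zero    _  = s≤s z≤n
root-< (suc r) (suc j) eq = s≤s (root-< r j eq)

-- The default `true` puts all roots in, so that `A ⊆ expand r A` says exactly that `A` is closed
-- under parents.
expand : ℕ → (ℕ → Bool) → ℕ → Bool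
expand r A j = maybe A true (parent r j)

count-expand : ∀ r m A → count (r + m * 2) (expand r A) ≡ r + count m A * 2
count-expand zero    m A = count-half m A
count-expand (suc r) m A = cong suc (count-expand r m A)

expand-mono : ∀ r {A B : ℕ → Bool} → (∀ j → A j ≡ true → B j ≡ true) →
              ∀ j → expand r A j ≡ true → expand r B j ≡ true
expand-mono r A⇒B j h with parent r j
... | just p  = A⇒B p h
... | nothing = refl

-- Ancestor-closed sets A and their frontiers ∂A

frontier : ℕ → (ℕ → Bool) → ℕ → Bool
frontier r A j = expand r A j ∧ not (A j)

record IsTop (r m : ℕ) (A : ℕ → Bool) : Set where
  field
    closed  : ∀ j → A j ≡ true → expand r A j ≡ true
    bounded : ∀ j → A j ≡ true → j < m

∅-isTop : ∀ r m → IsTop r m (const false)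
∅-isTop r m = record { closed = λ _ () ; bounded = λ _ () }

frontier⁺ : ∀ r A j → expand r A j ≡ true → A j ≢ true → frontier r A j ≡ true
frontier⁺ r A j ej ¬Aj rewrite ej | ¬-not ¬Aj = refl

frontier⁻ : ∀ r A j → frontier r A j ≡ true → A j ≢ true
frontier⁻ r A j h Aj with () ← trans (sym (cong not Aj)) (proj₂ (∧-true⁻ (expand r A j) h))

expand⁻ : ∀ r A j → expand r A j ≡ true → frontier r A j ≢ true → A j ≡ true
expand⁻ r A j ej ¬∂j = decidable-stable (A j ≟ᵇ true) (¬∂j ∘ frontier⁺ r A j ej)

m≤r+m*2 : ∀ r m → m ≤ r + m * 2
m≤r+m*2 r m = ≤-trans (m≤m*n m 2) (m≤n+m (m * 2) r)

count-frontier : ∀ r m {A} → IsTop r m A → count (r + m * 2) (frontier r A) ≡ r + count m A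
count-frontier r m {A} top = +-cancelˡ-≡ (count m A) _ _ (begin
  count m A + count N (frontier r A)  ≡⟨ cong (_+ count N (frontier r A)) (count-bounded (m≤r+m*2 r m) bounded) ⟨
  count N A + count N (frontier r A)  ≡⟨ count-split N (expand r A) A closed ⟨
  count N (expand r A)                ≡⟨ count-expand r m A ⟩
  r + count m A * 2                   ≡⟨ lemma r (count m A) ⟩
  count m A + (r + count m A)         ∎)
  where
  open ≡-Reasoning
  open IsTop top
  N = r + m * 2
  lemma : ∀ a b → a + b * 2 ≡ b + (a + b)
  lemma = solve-∀

-- The number of nodes of depth less than `x` in `r` complete binary trees. For
-- `m = internalNodes r x`, the total `r + m * 2` is `internalNodes r (suc x)` by definition.
internalNodes : ℕ → ℕ → ℕ
internalNodes r zero    = 0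
internalNodes r (suc x) = r + internalNodes r x * 2

-- Adding `r` turns the recurrence into doubling and avoids truncated subtraction.
internalNodes-closedForm : ∀ r x → internalNodes r x + r ≡ 2 ^ x * r
internalNodes-closedForm r zero    = sym (*-identityˡ r)
internalNodes-closedForm r (suc x) = begin
  r + internalNodes r x * 2 + r  ≡⟨ lemma r (internalNodes r x) ⟩
  2 * (internalNodes r x + r)    ≡⟨ cong (2 *_) (internalNodes-closedForm r x) ⟩
  2 * (2 ^ x * r)                ≡⟨ *-assoc 2 (2 ^ x) r ⟨
  2 * 2 ^ x * r                  ∎
  where
  open ≡-Reasoning
  lemma : ∀ a b → a + b * 2 + a ≡ 2 * (b + a)
  lemma = solve-∀

internalNodes-mono : ∀ r x → internalNodes r x ≤ internalNodes r (suc x)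
internalNodes-mono r x = m≤r+m*2 r (internalNodes r x)

-- A is the set of proper ancestors of v.
top-with-frontier : ∀ r → r ≥ 1 → ∀ x v q → parent r v ≡ q → v < internalNodes r (suc x) →
  ∃[ A ] (IsTop r (internalNodes r x) A × frontier r A v ≡ true × count (internalNodes r x) A ≤ x)
top-with-frontier r r≥1 x v nothing eq v< =
  const false , ∅-isTop r _ , frontier⁺ r _ v (cong (maybe _ true) eq) (λ ())
  , ≤-trans (≤-reflexive (count-false (internalNodes r x))) z≤n
-- Here there are no internal nodes, so `v` cannot have a parent.
top-with-frontier r r≥1 zero    v (just p) eq v< = contradiction (parent-<m r 0 v v< eq) n≮0
top-with-frontier r r≥1 (suc x) v (just p) eq v<
  with A , top , ∂p , ∣A∣≤x ← top-with-frontier r r≥1 x p (parent r p) refl (parent-<m r _ v v< eq) =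
  B , record { closed = closedB ; bounded = boundedB } , frontier⁺ r B v v∈exp v∉B , ∣B∣≤
  where
  open IsTop top
  m = internalNodes r (suc x)
  B = A ∪ᵇ⁅ p ⁆
  p<m : p < m
  p<m = parent-<m r m v v< eq
  closedB : ∀ j → B j ≡ true → expand r B j ≡ true
  closedB j Bj with ∪ᵇ⁻ A p Bj
  ... | inj₁ Aj   = expand-mono r (λ _ → ∪ᵇ-inˡ A p) j (closed j Aj)
  ... | inj₂ refl = expand-mono r (λ _ → ∪ᵇ-inˡ A p) j (proj₁ (∧-true⁻ (expand r A p) ∂p))
  boundedB : ∀ j → B j ≡ true → j < m
  boundedB j Bj with ∪ᵇ⁻ A p Bj
  ... | inj₁ Aj   = ≤-trans (bounded j Aj) (internalNodes-mono r x)
  ... | inj₂ refl = p<m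
  v∈exp : expand r B v ≡ true
  v∈exp = trans (cong (maybe B true) eq) (∪ᵇ-inʳ A p)
  -- If `v` were in `A`, closedness would put its parent `p` in `A`, but `p` lies on the frontier of
  -- `A`.
  v∉B : B v ≢ true
  v∉B Bv with ∪ᵇ⁻ A p Bv
  ... | inj₁ Av   = frontier⁻ r A p ∂p (trans (sym (cong (maybe A true) eq)) (closed v Av))
  ... | inj₂ refl = n≮n v (parent-<j r v r≥1 eq)
  ∣B∣≤ : count m B ≤ suc x
  ∣B∣≤ = ≤-trans (count-∪ᵇ m A p)
           (s≤s (≤-trans (≤-reflexive (count-bounded (internalNodes-mono r x) bounded)) ∣A∣≤x))

-- Nodes reached from the roots without meeting f; recursion on the fuel k, which
-- is sufficient as soon as it exceeds the node number.
reachFuel : ℕ → (ℕ → Bool) → ℕ → ℕ → Bool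
reachFuel r f zero    j = false
reachFuel r f (suc k) j = not (f j) ∧ expand r (reachFuel r f k) j

reach : ℕ → (ℕ → Bool) → ℕ → Bool
reach r f j = reachFuel r f (suc j) j

-- Each step to the parent costs one unit of fuel and lowers the node number by at least one, so
-- sufficient fuel never runs out.
reachFuel-stable : ∀ r f → r ≥ 1 → ∀ k l j → j < k → j < l → reachFuel r f k j ≡ reachFuel r f l j
reachFuel-stable r f r≥1 (suc k) (suc l) j j<k j<l with parent r j in eq
... | nothing = refl
... | just p  = cong (not (f j) ∧_) (reachFuel-stable r f r≥1 k l p
                  (<-≤-trans p<j (s≤s⁻¹ j<k)) (<-≤-trans p<j (s≤s⁻¹ j<l)))
  where
  p<j : p < j
  p<j = parent-<j r j r≥1 eq

reach-unfold : ∀ r f → r ≥ 1 → ∀ j → reach r f j ≡ not (f j) ∧ expand r (reach r f) j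
reach-unfold r f r≥1 j with parent r j in eq
... | nothing = refl
... | just p  = cong (not (f j) ∧_) (reachFuel-stable r f r≥1 j (suc p) p
                  (parent-<j r j r≥1 eq) ≤-refl)

reach-closed : ∀ r f → r ≥ 1 → ∀ j → reach r f j ≡ true → expand r (reach r f) j ≡ true
reach-closed r f r≥1 j h =
  proj₂ (∧-true⁻ (not (f j)) (trans (sym (reach-unfold r f r≥1 j)) h))

-- A frontier node is a root or a child of a reached node; not being reached itself, it must be
-- blocked by `f`.
frontier-reach : ∀ r f → r ≥ 1 → ∀ j → frontier r (reach r f) j ≡ true → f j ≡ true
frontier-reach r f r≥1 j h = decidable-stable (f j ≟ᵇ true) λ ¬fj →
  frontier⁻ r (reach r f) j h (trans (reach-unfold r f r≥1 j)
    (cong₂ _∧_ (cong not (¬-not ¬fj)) (proj₁ (∧-true⁻ (expand r (reach r f) j) h))))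

-- The whole chain of ancestors of a node of `A` lies in `A` and so misses `f`.
⊆reachFuel : ∀ r f A → r ≥ 1 → (∀ j → A j ≡ true → expand r A j ≡ true) →
             (∀ j → A j ≡ true → f j ≡ false) →
             ∀ k j → j < k → A j ≡ true → reachFuel r f k j ≡ true
⊆reachFuel r f A r≥1 closed A∩f (suc k) j j<k Aj rewrite A∩f j Aj
  with parent r j in eq | closed j Aj
... | nothing | _  = refl
... | just p  | Ap = ⊆reachFuel r f A r≥1 closed A∩f k p
  (<-≤-trans (parent-<j r j r≥1 eq) (s≤s⁻¹ j<k)) Ap

-- The graph

-- Nodes below `m` are internal and the remaining ones are leaves. The number `m` is kept general;
-- complete trees enter with `m = internalNodes r x`.
module ForestGraph (r m : ℕ) (r≥1 : r ≥ 1) where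

  N : ℕ
  N = r + m * 2

  Vertex : Set
  Vertex = Fin (2 + N)

  pattern s = zero
  pattern t = suc zero
  pattern node j = suc (suc j)

  -- Each edge is listed once, directed from `s` down towards `t`; `H` adds the reverse directions.
  Edge : Vertex → Vertex → Set
  Edge s        (node j) = parent r (toℕ j) ≡ nothing
  Edge (node i) t        = m ≤ toℕ i
  Edge (node i) (node j) = parent r (toℕ j) ≡ just (toℕ i)
  Edge _        _        = ⊥

  edge? : ∀ u v → Dec (Edge u v)
  edge? s        s        = no λ ()
  edge? s        t        = no λ ()
  edge? s        (node j) = Maybe.≡-dec _≟_ _ _
  edge? t        v        = no λ ()
  edge? (node i) s        = no λ ()
  edge? (node i) t        = m ≤? toℕ i
  edge? (node i) (node j) = Maybe.≡-dec _≟_ _ _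

  edge-irrefl : ∀ v → ¬ Edge v v
  edge-irrefl (node j) eq = n≮n (toℕ j) (parent-<j r (toℕ j) r≥1 eq)

  H : Graph (2 + N)
  H = record
    { Adj    = λ u v → Edge u v ⊎ Edge v u
    ; adj?   = λ u v → edge? u v ⊎-dec edge? v u
    ; sym    = swap
    ; irrefl = λ { {v} (inj₁ e) → edge-irrefl v e ; {v} (inj₂ e) → edge-irrefl v e }
    }

  X Y : Subset (2 + N)
  X = ⁅ s ⁆
  Y = ⁅ t ⁆

  nodes : Subset N → Subset (2 + N)
  nodes S = false ∷ false ∷ S

  nodes⊆∁ : ∀ S → nodes S ⊆ ∁ (X ∪ Y)
  nodes⊆∁ S {t} (there ())
  nodes⊆∁ S {node j} _ = x∉p⇒x∈∁p λ h → case-∪ (x∈p∪q⁻ X Y h)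
    where
    case-∪ : node j ∈ X ⊎ node j ∈ Y → ⊥
    case-∪ (inj₁ h) with () ← x∈⁅y⁆⇒x≡y s h
    case-∪ (inj₂ h) with () ← x∈⁅y⁆⇒x≡y t h

  ⊆∁⇒nodes : ∀ K → K ⊆ ∁ (X ∪ Y) → ∃[ S ] K ≡ nodes S
  ⊆∁⇒nodes (true  ∷ K)         K⊆ with () ← K⊆ here
  ⊆∁⇒nodes (false ∷ true  ∷ K) K⊆ with there () ← K⊆ (there here)
  ⊆∁⇒nodes (false ∷ false ∷ S) K⊆ = S , refl

  cut : (ℕ → Bool) → Subset N
  cut A = subset N (frontier r A)

  node∈cut : ∀ {A} j → frontier r A (toℕ j) ≡ true → node j ∈ nodes (cut A)
  node∈cut j ∂j = there (there (mem⇒∈ _ j (trans (mem-subset N _ (toℕ<n j)) ∂j)))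

  ∣cut∣ : ∀ {A} → IsTop r m A → ∣ nodes (cut A) ∣ ≡ r + count m A
  ∣cut∣ top = trans (∣subset∣ N _) (count-frontier r m top)

  -- The cuts ∂A separate s from t

  module _ {A : ℕ → Bool} (top : IsTop r m A) where

    open IsTop top

    Above : Vertex → Set
    Above s        = ⊤
    Above t        = ⊥
    Above (node j) = A (toℕ j) ≡ true

    Above⇒∉cut : ∀ v → Above v → v ∉ nodes (cut A)
    Above⇒∉cut (node j) Aj (there (there h)) =
      frontier⁻ r A (toℕ j) (trans (sym (mem-subset N _ (toℕ<n j))) (∈⇒mem h)) Aj

    -- Going down from `s` or from `A` leads to a root or a child of `A`, which off the cut lies in
    -- `A`. Going up stays in `A` or reaches `s`. Only leaves are adjacent to `t`, and `A` has none
    -- by `bounded`.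
    Above-step : ∀ u v → AdjAvoiding H (nodes (cut A)) u v → Above u → Above v
    Above-step s        s        _               _  = tt
    Above-step (node i) s        _               _  = tt
    Above-step s        t        (_ , _ , inj₁ ()) _
    Above-step s        t        (_ , _ , inj₂ ()) _
    Above-step s        (node j) (_ , ∉ , inj₁ e) _ =
      expand⁻ r A (toℕ j) (cong (maybe A true) e) (∉ ∘ node∈cut j)
    Above-step (node i) t        (_ , _ , inj₁ e) Ai = <⇒≱ (bounded (toℕ i) Ai) e
    Above-step (node i) (node j) (_ , ∉ , inj₁ e) Ai =
      expand⁻ r A (toℕ j) (trans (cong (maybe A true) e) Ai) (∉ ∘ node∈cut j)
    Above-step (node i) (node j) (_ , _ , inj₂ e) Ai =
      trans (sym (cong (maybe A true) e)) (closed (toℕ i) Ai)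

    Above-path : ∀ {u v} → Star (AdjAvoiding H (nodes (cut A))) u v → Above u → Above v
    Above-path ε        a = a
    Above-path (e ◅ es) a = Above-path es (Above-step _ _ e a)

    -- Paths in `NR H Y` start at `t`, so the invariant must also travel from the end of a path to
    -- its start.
    Above-path⁻ : ∀ {u v} → Star (AdjAvoiding H (nodes (cut A))) u v → Above v → Above u
    Above-path⁻ ε                  a = a
    Above-path⁻ ((p , q , e) ◅ es) a = Above-step _ _ (q , p , swap e) (Above-path⁻ es a)

    cut-isSeparator : IsSeparator H X Y (nodes (cut A))
    cut-isSeparator = nodes⊆∁ (cut A) , λ { (y , y∈Y , a , a∈X , _ , path) → no-path y∈Y a∈X path }
      where
      no-path : ∀ {a y} → y ∈ Y → a ∈ X → ¬ Star (AdjAvoiding H (nodes (cut A))) a y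
      no-path y∈Y a∈X path with refl ← x∈⁅y⁆⇒x≡y t y∈Y | refl ← x∈⁅y⁆⇒x≡y s a∈X = Above-path path tt

    -- Any `K′` that exceeds the cut in the order `≺*` has these vertices in its own `NR` set, and
    -- hence avoids `A`.
    Above⇒NR : ∀ v → Above v → NR H Y (nodes (cut A)) v
    Above⇒NR v av = Above⇒∉cut v av , λ { (a , a∈Y , _ , path) → no-path a∈Y path }
      where
      no-path : ∀ {a} → a ∈ Y → ¬ Star (AdjAvoiding H (nodes (cut A))) a v
      no-path a∈Y path with refl ← x∈⁅y⁆⇒x≡y t a∈Y = Above-path⁻ path av

  -- Nodes reached from s downwards, avoiding a given set

  module _ (S : Subset N) where

    s∉nodes : s ∉ nodes S
    s∉nodes ()

    t∉nodes : t ∉ nodes S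
    t∉nodes (there ())

    reachFuel⇒∉ : ∀ k j → reachFuel r (mem S) k (toℕ j) ≡ true → node j ∉ nodes S
    reachFuel⇒∉ (suc k) j h (there (there j∈S)) rewrite ∈⇒mem j∈S with () ← h

    reachFuel⇒path : ∀ k j → reachFuel r (mem S) k (toℕ j) ≡ true →
                     Star (AdjAvoiding H (nodes S)) s (node j)
    reachFuel⇒path (suc k) j h
      with parent r (toℕ j) in eq | reachFuel⇒∉ (suc k) j h | proj₂ (∧-true⁻ (not (mem S (toℕ j))) h)
    ... | nothing | j∉S | _  = (s∉nodes , j∉S , inj₁ eq) ◅ ε
    ... | just p  | j∉S | hp =
      reachFuel⇒path k i hi
      ◅◅ (reachFuel⇒∉ k i hi , j∉S , inj₁ (trans eq (cong just (sym i≡p)))) ◅ ε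
      where
      p<N : p < N
      p<N = ≤-<-trans (≤-trans (m≤n+m p r) (parent-≤ r (toℕ j) eq)) (toℕ<n j)
      i : Fin N
      i = fromℕ< p<N
      i≡p : toℕ i ≡ p
      i≡p = toℕ-fromℕ< p<N
      hi : reachFuel r (mem S) k (toℕ i) ≡ true
      hi = trans (cong (reachFuel r (mem S) k) i≡p) hp

  module _ {S : Subset N} (sep : IsSeparator H X Y (nodes S)) where

    private
      R : ℕ → Bool
      R = reach r (mem S)

    -- A reached leaf would complete a path from `s` to `t`, against `sep`.
    reach-boundedN : ∀ j → j < N → R j ≡ true → j < m
    reach-boundedN j j<N Rj with j <? m
    ... | yes j<m = j<m
    ... | no  j≮m = ⊥-elim (proj₂ sep (t , x∈⁅x⁆ t , s , x∈⁅x⁆ s , t∉nodes S ,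
            (reachFuel⇒path S (suc j) i Ri ◅◅ (reachFuel⇒∉ S (suc j) i Ri , t∉nodes S , inj₁ m≤i) ◅ ε)))
      where
      i : Fin N
      i = fromℕ< j<N
      i≡j : toℕ i ≡ j
      i≡j = toℕ-fromℕ< j<N
      Ri : reachFuel r (mem S) (suc j) (toℕ i) ≡ true
      Ri = trans (cong (reachFuel r (mem S) (suc j)) i≡j) Rj
      m≤i : m ≤ toℕ i
      m≤i = ≤-trans (≮⇒≥ j≮m) (≤-reflexive (sym i≡j))

    -- Since `mem S` is `false` from `N` on, numbers outside the forest must be excluded as well. A
    -- non-root has a reached parent, which is below `m` by induction, so the child is below `N`.
    reach-bounded : ∀ k j → j < k → R j ≡ true → j < m
    reach-bounded (suc k) j j<k Rj with parent r j in eq | reach-closed r (mem S) r≥1 j Rj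
    ... | nothing | _  = reach-boundedN j (<-≤-trans (root-< r j eq) (m≤m+n r (m * 2))) Rj
    ... | just p  | Rp = reach-boundedN j (child-< r m j eq (reach-bounded k p p<k Rp)) Rj
      where
      p<k : p < k
      p<k = <-≤-trans (parent-<j r j r≥1 eq) (s≤s⁻¹ j<k)

    reach-isTop : IsTop r m R
    reach-isTop = record
      { closed  = reach-closed r (mem S) r≥1
      ; bounded = λ j → reach-bounded (suc j) j ≤-refl
      }

    module _ {A : ℕ → Bool} (top : IsTop r m A)
             (A∩S : ∀ j → A j ≡ true → mem S j ≡ false) where

      open IsTop top

      A⊆reach : ∀ j → A j ≡ true → R j ≡ true
      A⊆reach j = ⊆reachFuel r (mem S) A r≥1 closed A∩S (suc j) j ≤-refl

      ∣A∣≤∣R∣ : count m A ≤ count m R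
      ∣A∣≤∣R∣ = count-mono m (λ j _ → A⊆reach j)

      r+∣R∣≤∣S∣ : r + count m R ≤ ∣ S ∣
      r+∣R∣≤∣S∣ = begin
        r + count m R         ≡⟨ count-frontier r m reach-isTop ⟨
        count N (frontier r R) ≤⟨ count-mono N (λ j _ → frontier-reach r (mem S) r≥1 j) ⟩
        count N (mem S)       ≡⟨ ∣S∣≡count S ⟨
        ∣ S ∣                 ∎
        where open ≤-Reasoning

      ∣cut∣≤ : ∣ nodes (cut A) ∣ ≤ ∣ S ∣
      ∣cut∣≤ = begin
        ∣ cut A ∣      ≡⟨ ∣cut∣ top ⟩
        r + count m A  ≤⟨ +-monoʳ-≤ r ∣A∣≤∣R∣ ⟩
        r + count m R  ≤⟨ r+∣R∣≤∣S∣ ⟩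
        ∣ S ∣          ∎
        where open ≤-Reasoning

      -- Equality holds throughout |∂A| ≤ |∂R| ≤ |S|. The first equality gives `R = A`; then ∂A = ∂R
      -- is contained in `S` and is no smaller, so it is `S`.
      cut-unique : ∣ S ∣ ≤ ∣ nodes (cut A) ∣ → cut A ≡ S
      cut-unique ∣S∣≤ = subset-cong N (count-antisym N ∂A⊆S
          (subst₂ _≤_ (∣S∣≡count S) (∣subset∣ N _) ∣S∣≤))
        where
        ∣R∣≤∣A∣ : count m R ≤ count m A
        ∣R∣≤∣A∣ = +-cancelˡ-≤ r _ _ (≤-trans r+∣R∣≤∣S∣ (≤-trans ∣S∣≤ (≤-reflexive (∣cut∣ top))))
        R⊆A : ∀ j → R j ≡ true → A j ≡ true
        R⊆A j Rj = trans (count-antisym m (λ j _ → A⊆reach j) ∣R∣≤∣A∣ j (IsTop.bounded reach-isTop j Rj)) Rj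
        ∂A⊆S : ∀ j → j < N → frontier r A j ≡ true → mem S j ≡ true
        ∂A⊆S j _ ∂j = frontier-reach r (mem S) r≥1 j (frontier⁺ r R j
          (expand-mono r A⊆reach j (proj₁ (∧-true⁻ (expand r A j) ∂j)))
          (λ Rj → frontier⁻ r A j ∂j (R⊆A j Rj)))

  -- Importance of the cuts

  avoids : ∀ {S A} → IsTop r m A → (∀ j → A (toℕ j) ≡ true → node j ∉ nodes S) →
           ∀ j → A j ≡ true → mem S j ≡ false
  avoids {S} {A} top A⇒∉ j Aj = ¬-not λ j∈S →
    A⇒∉ i (trans (cong A i≡j) Aj) (there (there (mem⇒∈ S i (trans (cong (mem S) i≡j) j∈S))))
    where
    j<N : j < N
    j<N = <-≤-trans (IsTop.bounded top j Aj) (m≤r+m*2 r m)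
    i : Fin N
    i = fromℕ< j<N
    i≡j : toℕ i ≡ j
    i≡j = toℕ-fromℕ< j<N

  cut-isImportant : ∀ {A} → IsTop r m A → IsImportantSeparator H X Y (nodes (cut A))
  cut-isImportant {A} top = (cut-isSeparator top , minimal) , important
    where
    -- `K′` avoids `A` because the larger cut does, so it is at least as large as the cut.
    minimal : ∀ K′ → K′ ⊂ nodes (cut A) → ¬ IsSeparator H X Y K′
    minimal K′ K′⊂ sep with S , refl ← ⊆∁⇒nodes K′ (proj₁ sep) =
      <⇒≱ (p⊂q⇒∣p∣<∣q∣ K′⊂)
          (∣cut∣≤ sep top (avoids top λ j Aj → Above⇒∉cut top (node j) Aj ∘ proj₁ K′⊂))
    important : ¬ (∃[ K′ ] (IsSeparator H X Y K′ × _≺*_ H X Y (nodes (cut A)) K′ × ∣ nodes (cut A) ∣ ≥ ∣ K′ ∣))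
    important (K′ , sep , (NR⊆ , NR⊉) , ∣K′∣≤) with S , refl ← ⊆∁⇒nodes K′ (proj₁ sep)
      -- `K′` avoids `A` and is no larger than the cut, so it is the cut, and the inclusion of `NR`
      -- sets cannot be proper.
      with refl ← cut-unique sep top
                    (avoids top λ j Aj → proj₁ (NR⊆ (Above⇒NR top (node j) Aj))) ∣K′∣≤ =
      NR⊉ (λ h → h)

  -- Smallest separators and excess

  cut∅ : Subset (2 + N)
  cut∅ = nodes (cut (const false))

  ∣cut∅∣ : ∣ cut∅ ∣ ≡ r
  ∣cut∅∣ = trans (∣cut∣ (∅-isTop r m)) (trans (cong (r +_) (count-false m)) (+-identityʳ r))

  -- Every separator avoids the empty set, whose cut consists of the `r` roots.
  r≤∣separator∣ : ∀ K → IsSeparator H X Y K → r ≤ ∣ K ∣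
  r≤∣separator∣ K sep with S , refl ← ⊆∁⇒nodes K (proj₁ sep) =
    subst (_≤ ∣ S ∣) ∣cut∅∣ (∣cut∣≤ sep (∅-isTop r m) (λ _ ()))

  smallestSeparator : SmallestSize (IsSeparator H X Y) r
  smallestSeparator = (cut∅ , cut-isSeparator (∅-isTop r m) , ∣cut∅∣) , r≤∣separator∣

  smallestImportant : SmallestSize (IsImportantSeparator H X Y) r
  smallestImportant = (cut∅ , cut-isImportant (∅-isTop r m) , ∣cut∅∣)
                    , λ K imp → r≤∣separator∣ K (proj₁ (proj₁ imp))

  cut-excess : ∀ {A} → IsTop r m A → HasExcess H X Y (nodes (cut A)) (count m A)
  cut-excess {A} top = r , smallestImportant ,
    sym (trans (cong (_∸ r) (∣cut∣ top)) (m+n∸m≡n r (count m A)))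

  -- The union of the important separators

  allNodes : Subset (2 + N)
  allNodes = nodes (subset N (const true))

  ∣allNodes∣ : ∣ allNodes ∣ ≡ N
  ∣allNodes∣ = trans (∣subset∣ N _) (count-true N)

  node∈allNodes : ∀ j → node j ∈ allNodes
  node∈allNodes j = there (there (mem⇒∈ _ j (mem-subset N _ (toℕ<n j))))

  separator⊆allNodes : ∀ {K v} → IsSeparator H X Y K → v ∈ K → v ∈ allNodes
  separator⊆allNodes {K} {v} sep v∈K with S , refl ← ⊆∁⇒nodes K (proj₁ sep) = go v∈K
    where
    go : ∀ {v} → v ∈ nodes S → v ∈ allNodes
    go (there (there {i = j} _)) = node∈allNodes j

allNodes-isUnion : ∀ r x (r≥1 : r ≥ 1) → let open ForestGraph r (internalNodes r x) r≥1 in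
  IsUnionOf (ImportantOfExcessAtMost H X Y x) allNodes
allNodes-isUnion r x r≥1 v = mk⇔ (cover v) (λ { (S , (imp , _) , v∈S) → separator⊆allNodes (proj₁ (proj₁ imp)) v∈S })
  where
  open ForestGraph r (internalNodes r x) r≥1
  cover : ∀ v → v ∈ allNodes → ∃[ S ] (ImportantOfExcessAtMost H X Y x S × v ∈ S)
  -- `N` is `internalNodes r (suc x)` by definition, so `toℕ<n j` is the required bound. The excess
  -- of the cut is `count m A`, which is at most `x`.
  cover (node j) _ with A , top , ∂j , ∣A∣≤x ← top-with-frontier r r≥1 x (toℕ j) _ refl (toℕ<n j) =
    nodes (cut A) , (cut-isImportant top , _ , cut-excess top , ∣A∣≤x) , node∈cut j ∂j
  cover t (there ())

nodes-total : ∀ r x → internalNodes r (suc x) ≡ 2 ^ (x + 1) * r ∸ r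
nodes-total r x = begin
  internalNodes r (suc x)           ≡⟨ m+n∸n≡m _ r ⟨
  internalNodes r (suc x) + r ∸ r   ≡⟨ cong (_∸ r) (internalNodes-closedForm r (suc x)) ⟩
  2 ^ suc x * r ∸ r                 ≡⟨ cong (λ k → 2 ^ k * r ∸ r) (+-comm 1 x) ⟩
  2 ^ (x + 1) * r ∸ r               ∎
  where open ≡-Reasoning

theorem4 : (x r : ℕ) → r ≥ 1 →
    ∃[ n ] Σ[ H ∈ Graph n ] Σ[ s ∈ Fin n ] Σ[ t ∈ Fin n ]
    (s ≢ t
    × SmallestSize (IsSeparator H ⁅ s ⁆ ⁅ t ⁆) r
    × Σ[ U ∈ Subset n ]
    (IsUnionOf (ImportantOfExcessAtMost H ⁅ s ⁆ ⁅ t ⁆ x) U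
    × ∣ U ∣ ≡ 2 ^ (x + 1) * r ∸ r))
theorem4 x r r≥1 =
  2 + F.N , F.H , zero , suc zero , (λ ()) , F.smallestSeparator ,
  F.allNodes , allNodes-isUnion r x r≥1 , trans F.∣allNodes∣ (nodes-total r x)
  where module F = ForestGraph r (internalNodes r x) r≥1
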